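{- Let $g_1,\dots,g_N$ ($N\ge 1$) be linear polynomials over $\mathbb{Q}$ in the variables $x_1,\dots,x_n$, each depending on at least $\frac{n}{2}$ variables (i.e. having at least $n/2$ variables with nonzero coefficient), such that the linear clause $\bigvee_{j\in[N]} g_j=0$ is a tautology (true under every 0-1 assignment). Then every tree-like $\mathrm{Res}(\mathrm{lin}_{\mathbb{Q}})$ derivation of $\bigvee_{j\in[N]} g_j=0$ (from the boolean axioms alone) has size $2^{\Omega(\sqrt{n})}$.
   Context: A linear clause over a ring $R$ is a disjunction $(f_1=0)\vee\dots\vee(f_k=0)$ of linear equations with linear forms over $R$ (duplicate disjuncts identified); variables range over $\{0,1\}$. The proof system $\mathrm{Res}(\mathrm{lin}_R)$ has the boolean axioms $x=0\vee x=1$ for every variable $x$ and the rules: resolution (from $C\vee f=0$ and $D\vee g=0$ derive $C\vee D\vee(\alpha f+\beta g=0)$, $\alpha,\beta\in R$), simplification (from $C\vee a=0$ with $a\in R\setminus\{0\}$ a constant derive $C$), weakening (from $C$ derive $C\vee f=0$). A derivation of $D$ is a sequence of linear clauses ending in $D$, each a boolean axiom or obtained from earlier clauses by a rule; it is tree-like if every occurrence of a clause is used at most once as a premise. Size is the total number of variable occurrences plus the total bit-size of coefficients. -}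

module Defs where

open import Data.Nat as ℕ using (ℕ; zero; suc)
open import Data.Nat.Logarithm using (⌈log₂_⌉)
open import Data.Integer as ℤ using (ℤ)
open import Data.Rational as ℚ using (ℚ; 0ℚ; 1ℚ; ↥_; ↧ₙ_)
open import Data.Bool using (Bool; true; false)
open import Data.Fin using (Fin)
open import Data.Vec as Vec using (Vec)
open import Data.List as List using (List; []; _∷_; _++_)
open import Data.List.Relation.Binary.Subset.Propositional using (_⊆_)
open import Data.List.Membership.Propositional using (_∈_)
open import Data.Nat.ListAction using (sum)
open import Data.Product using (_×_; Σ)
open import Relation.Nullary using (¬_; Dec; yes; no)
open import Relation.Binary.PropositionalEquality using (_≡_)

-- A linear form over ℚ in the variables x_0..x_{n-1}:  Σ coeffs[i]·x_i + const.
-- (ℚ from Data.Rational is normalised, so _≡_ on forms is equality of forms.)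
record Form (n : ℕ) : Set where
  constructor form
  field
    coeffs : Vec ℚ n
    const  : ℚ
open Form public

-- A linear clause: the disjunction of (f = 0) for f in the list.
-- Clauses are compared as SETS of disjuncts (duplicates identified).
Clause : ℕ → Set
Clause n = List (Form n)

_≈_ : ∀ {n} → Clause n → Clause n → Set
A ≈ B = (A ⊆ B) × (B ⊆ A)

Assignment : ℕ → Set
Assignment n = Fin n → Bool

bool→ℚ : Bool → ℚ
bool→ℚ true  = 1ℚ
bool→ℚ false = 0ℚ

evalForm : ∀ {n} → Form n → Assignment n → ℚ
evalForm {n} (form a c) ρ =
  Vec.foldr (λ _ → ℚ) ℚ._+_ c
    (Vec.zipWith (λ ai xi → ai ℚ.* bool→ℚ xi) a (Vec.tabulate ρ))

lincomb : ∀ {n} → ℚ → Form n → ℚ → Form n → Form n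
lincomb α (form a c) β (form b d) =
  form (Vec.zipWith (λ u v → α ℚ.* u ℚ.+ β ℚ.* v) a b) (α ℚ.* c ℚ.+ β ℚ.* d)

var : ∀ {n} → Fin n → Form n
var i = form (Vec.updateAt (Vec.replicate _ 0ℚ) i (λ _ → 1ℚ)) 0ℚ

varMinus1 : ∀ {n} → Fin n → Form n
varMinus1 i = form (Form.coeffs (var i)) (ℚ.- 1ℚ)

constForm : ∀ {n} → ℚ → Form n
constForm a = form (Vec.replicate _ 0ℚ) a

-- Tree-like Res(lin_ℚ) derivations from the boolean axioms, indexed by the
-- derived clause.  "C ∨ f = 0" for a clause Γ means Γ ≈ f ∷ C.
data Deriv {n : ℕ} : Clause n → Set where
  axiom : ∀ {Γ} (i : Fin n) → Γ ≈ (var i ∷ varMinus1 i ∷ []) → Deriv Γ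
  res   : ∀ {Γ₁ Γ₂ Δ} (f g : Form n) (C D : Clause n) (α β : ℚ) →
          Deriv Γ₁ → Deriv Γ₂ →
          Γ₁ ≈ (f ∷ C) → Γ₂ ≈ (g ∷ D) →
          Δ ≈ (C ++ D ++ (lincomb α f β g ∷ [])) → Deriv Δ
  simp  : ∀ {Γ Δ} (a : ℚ) (C : Clause n) → ¬ (a ≡ 0ℚ) →
          Deriv Γ → Γ ≈ (constForm a ∷ C) → Δ ≈ C → Deriv Δ
  weak  : ∀ {Γ Δ} (f : Form n) → Deriv Γ → Δ ≈ (f ∷ Γ) → Deriv Δ

isZero : ℚ → Bool
isZero q with q ℚ.≟ 0ℚ
... | yes _ = true
... | no  _ = false

nnz : ∀ {n} → Form n → ℕ
nnz f = Vec.foldr (λ _ → ℕ) (λ q k → if0 q k) 0 (Form.coeffs f)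
  where
  if0 : ℚ → ℕ → ℕ
  if0 q k with isZero q
  ... | true  = k
  ... | false = suc k

bits : ℕ → ℕ
bits m = ⌈log₂ (suc m) ⌉

bitsizeℚ : ℚ → ℕ
bitsizeℚ q with isZero q
... | true  = 0
... | false = bits (ℤ.∣ ↥ q ∣) ℕ.+ bits (↧ₙ q)

formSize : ∀ {n} → Form n → ℕ
formSize f = nnz f ℕ.+
  Vec.foldr (λ _ → ℕ) (λ q k → bitsizeℚ q ℕ.+ k) (bitsizeℚ (Form.const f)) (Form.coeffs f)

clauseSize : ∀ {n} → Clause n → ℕ
clauseSize Γ = sum (List.map formSize Γ)

size : ∀ {n} {Γ : Clause n} → Deriv Γ → ℕ
size {Γ = Γ} (axiom i _) = clauseSize Γ
size {Γ = Γ} (res f g C D α β d₁ d₂ _ _ _) = clauseSize Γ ℕ.+ size d₁ ℕ.+ size d₂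
size {Γ = Γ} (simp a C _ d _ _) = clauseSize Γ ℕ.+ size d
size {Γ = Γ} (weak f d _) = clauseSize Γ ℕ.+ size d

bigClause : ∀ {n N} → Vec (Form n) N → Clause n
bigClause g = Vec.toList g

Tautology : ∀ {n} → Clause n → Set
Tautology {n} Γ = (ρ : Assignment n) → Σ (Form n) λ f → (f ∈ Γ) × (evalForm f ρ ≡ 0ℚ)

-- A path of the derivation, read from the conclusion towards the axioms, accumulates a satisfiable
-- set Ψ of disequalities f ≠ 0.  At a resolution step whose premises resolve on f and g, if Ψ forces
-- f = 0 or g = 0 then only the other premise is followed; otherwise both are followed, with f ≠ 0
-- respectively g ≠ 0 added to Ψ, which doubles the size bound.  Throughout, each form h of the
-- current clause is, on the solutions of Ψ, either nonzero or a nonzero multiple of some g_j.  An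
-- axiom cannot meet this condition while Ψ is small: fixing one variable would make g_j constant on
-- the solutions of Ψ.  That is impossible: flipping, at a solution of Ψ, coordinates that all
-- increase (or all decrease) g_j leaves its level, so by Alon–Füredi the product of Ψ, which would
-- vanish there, has degree at least half the number of variables of g_j.  This gives
-- size ≥ 2^Ω(n), of which only 2^√n is needed.
module Submission where

open import Defs
open import Data.Nat using (ℕ; _≤_; _*_; _^_)
open import Data.Fin using (Fin)
open import Data.Vec using (Vec; lookup)
open import Data.Product using (Σ)

open import Data.Bool using (Bool; true; false; not; if_then_else_)
open import Data.Empty using (⊥-elim)
open import Data.Fin using (zero; suc)
open import Data.List using (List; []; _∷_; length)
open import Data.List.Membership.Propositional using (_∈_)
open import Data.List.Membership.Propositional.Properties using (∈-++⁺ˡ; ∈-++⁺ʳ)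
open import Data.List.Relation.Unary.Any using (here; there)
open import Data.Nat as ℕ using (zero; suc; z≤n; s≤s)
import Data.Nat.Properties as ℕₚ
open import Data.Nat.Solver using (module +-*-Solver)
open import Data.Product using (_×_; _,_; ∃)
open import Data.Rational as ℚ using (ℚ; 0ℚ; 1ℚ; _-_)
import Data.Rational.Properties as ℚₚ
import Data.Rational.Solver as ℚ-Solver
open import Algebra.Properties.Group ℚₚ.+-0-group using (x∙y⁻¹≈ε⇒x≈y)
  renaming (∙-cancelʳ to +-cancelʳ)
open import Data.Sum using (_⊎_; inj₁; inj₂)
open import Data.Unit using (⊤; tt)
open import Data.Vec as Vec using ([]; _∷_)
import Data.Vec.Membership.Propositional.Properties as Vec∈ₚ
import Data.Vec.Relation.Unary.Any as VecAny
import Data.Vec.Relation.Unary.Any.Properties as VecAnyₚ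
open import Level using (0ℓ)
open import Relation.Binary.Core using (Rel)
open import Relation.Binary.Definitions using (Decidable; Transitive; tri<; tri≈; tri>)
open import Relation.Binary.PropositionalEquality
  using (_≡_; _≢_; refl; sym; trans; cong; cong₂; subst; module ≡-Reasoning)
open import Relation.Nullary using (¬_; yes; no)
open import Relation.Nullary.Decidable using (⌊_⌋)

-- Cancellation and ring identities over the rationals

*-cancelˡ-≢0 : ∀ {c p q} → c ≢ 0ℚ → c ℚ.* p ≡ c ℚ.* q → p ≡ q
*-cancelˡ-≢0 {c} {p} {q} c≢0 eq = begin
  p                          ≡⟨ ℚₚ.*-identityˡ p ⟨
  1ℚ ℚ.* p                   ≡⟨ cong (ℚ._* p) (ℚₚ.*-inverseˡ c) ⟨
  (ℚ.1/ c) ℚ.* c ℚ.* p       ≡⟨ ℚₚ.*-assoc (ℚ.1/ c) c p ⟩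
  (ℚ.1/ c) ℚ.* (c ℚ.* p)     ≡⟨ cong ((ℚ.1/ c) ℚ.*_) eq ⟩
  (ℚ.1/ c) ℚ.* (c ℚ.* q)     ≡⟨ ℚₚ.*-assoc (ℚ.1/ c) c q ⟨
  (ℚ.1/ c) ℚ.* c ℚ.* q       ≡⟨ cong (ℚ._* q) (ℚₚ.*-inverseˡ c) ⟩
  1ℚ ℚ.* q                   ≡⟨ ℚₚ.*-identityˡ q ⟩
  q                          ∎
  where
  open ≡-Reasoning
  instance _ = ℚ.≢-nonZero c≢0

*-≢0 : ∀ {p q} → p ≢ 0ℚ → q ≢ 0ℚ → p ℚ.* q ≢ 0ℚ
*-≢0 {p} p≢0 q≢0 pq≡0 = q≢0 (*-cancelˡ-≢0 p≢0 (trans pq≡0 (sym (ℚₚ.*-zeroʳ p))))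

module Identities where
  open ℚ-Solver.+-*-Solver

  linear-Δ : ∀ u v p₁ p₀ q₁ q₀ →
    (u ℚ.* p₁ ℚ.+ v ℚ.* q₁) - (u ℚ.* p₀ ℚ.+ v ℚ.* q₀) ≡ u ℚ.* (p₁ - p₀) ℚ.+ v ℚ.* (q₁ - q₀)
  linear-Δ = solve 6 (λ u v p₁ p₀ q₁ q₀ →
    (u :* p₁ :+ v :* q₁) :- (u :* p₀ :+ v :* q₀) := u :* (p₁ :- p₀) :+ v :* (q₁ :- q₀)) refl

  shift-const : ∀ a b D k p q →
    (a ℚ.* b ℚ.+ D ℚ.+ k) ℚ.* p ≡ 1ℚ ℚ.* ((D ℚ.+ (a ℚ.* b ℚ.+ k)) ℚ.* p) ℚ.+ 0ℚ ℚ.* q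
  shift-const = solve 6 (λ a b D k p q →
    (a :* b :+ D :+ k) :* p := con 1ℚ :* ((D :+ (a :* b :+ k)) :* p) :+ con 0ℚ :* q) refl

  affine-Δ : ∀ a D k p₁ p₀ →
    (a ℚ.* 1ℚ ℚ.+ D ℚ.+ k) ℚ.* p₁ - (a ℚ.* 0ℚ ℚ.+ D ℚ.+ k) ℚ.* p₀ ≡
    a ℚ.* p₀ ℚ.+ 1ℚ ℚ.* ((D ℚ.+ (a ℚ.+ k)) ℚ.* (p₁ - p₀))
  affine-Δ = solve 5 (λ a D k p₁ p₀ →
    (a :* con 1ℚ :+ D :+ k) :* p₁ :- (a :* con 0ℚ :+ D :+ k) :* p₀ :=
    a :* p₀ :+ con 1ℚ :* ((D :+ (a :+ k)) :* (p₁ :- p₀))) refl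

  lincomb-step : ∀ α β u v b D E →
    (α ℚ.* u ℚ.+ β ℚ.* v) ℚ.* b ℚ.+ (α ℚ.* D ℚ.+ β ℚ.* E) ≡
    α ℚ.* (u ℚ.* b ℚ.+ D) ℚ.+ β ℚ.* (v ℚ.* b ℚ.+ E)
  lincomb-step = solve 7 (λ α β u v b D E →
    (α :* u :+ β :* v) :* b :+ (α :* D :+ β :* E) := α :* (u :* b :+ D) :+ β :* (v :* b :+ E)) refl

  lincomb-const : ∀ α β D E c d →
    α ℚ.* D ℚ.+ β ℚ.* E ℚ.+ (α ℚ.* c ℚ.+ β ℚ.* d) ≡ α ℚ.* (D ℚ.+ c) ℚ.+ β ℚ.* (E ℚ.+ d)
  lincomb-const = solve 6 (λ α β D E c d →
    α :* D :+ β :* E :+ (α :* c :+ β :* d) := α :* (D :+ c) :+ β :* (E :+ d)) refl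

open Identities

-- Polynomial functions on the cube

⟦_⟧ : Bool → ℚ
⟦_⟧ = bool→ℚ

dot : ∀ {s} → Vec ℚ s → Vec Bool s → ℚ
dot []       []      = 0ℚ
dot (a ∷ as) (b ∷ x) = a ℚ.* ⟦ b ⟧ ℚ.+ dot as x

-- DegreeBelow d P: the multilinear polynomial representing P has degree < d.
DegreeBelow : ∀ {s} → ℕ → (Vec Bool s → ℚ) → Set
DegreeBelow             zero    P = ∀ x → P x ≡ 0ℚ
DegreeBelow {s = zero}  (suc d) P = ⊤
DegreeBelow {s = suc s} (suc d) P =
  (∀ b → DegreeBelow (suc d) (λ x → P (b ∷ x))) ×
  DegreeBelow d (λ x → P (true ∷ x) - P (false ∷ x))

-- Asking for `R` only up to pointwise equality makes this, with coefficients 1 and 0, also the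
-- transport of a degree bound between pointwise equal functions.
degreeBelow-linear : ∀ {s} d {P Q R : Vec Bool s → ℚ} (u v : ℚ) →
  DegreeBelow d P → DegreeBelow d Q →
  (∀ x → R x ≡ u ℚ.* P x ℚ.+ v ℚ.* Q x) → DegreeBelow d R
degreeBelow-linear zero u v dP dQ eq x = trans (eq x) (begin
  u ℚ.* _ ℚ.+ v ℚ.* _    ≡⟨ cong₂ (λ p q → u ℚ.* p ℚ.+ v ℚ.* q) (dP x) (dQ x) ⟩
  u ℚ.* 0ℚ ℚ.+ v ℚ.* 0ℚ  ≡⟨ cong₂ ℚ._+_ (ℚₚ.*-zeroʳ u) (ℚₚ.*-zeroʳ v) ⟩
  0ℚ                     ∎)
  where open ≡-Reasoning
degreeBelow-linear {zero}  (suc d) u v dP dQ eq = tt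
degreeBelow-linear {suc s} (suc d) {P} {Q} u v (dP , dΔP) (dQ , dΔQ) eq =
  (λ b → degreeBelow-linear (suc d) u v (dP b) (dQ b) (λ x → eq (b ∷ x))) ,
  degreeBelow-linear d u v dΔP dΔQ (λ x →
    trans (cong₂ _-_ (eq (true ∷ x)) (eq (false ∷ x)))
      (linear-Δ u v (P (true ∷ x)) (P (false ∷ x)) (Q (true ∷ x)) (Q (false ∷ x))))

degreeBelow-suc : ∀ {s} d {P : Vec Bool s → ℚ} → DegreeBelow d P → DegreeBelow (suc d) P
degreeBelow-suc {zero}  d       dP         = tt
degreeBelow-suc {suc s} zero    dP         =
  (λ b → degreeBelow-suc zero (λ x → dP (b ∷ x))) ,
  (λ x → cong₂ _-_ (dP (true ∷ x)) (dP (false ∷ x)))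
degreeBelow-suc {suc s} (suc d) (dP , dΔP) =
  (λ b → degreeBelow-suc (suc d) (dP b)) , degreeBelow-suc d dΔP

-- Discrete product rule: the difference of the product in the first coordinate is `a` times a
-- restriction of `P`, plus an affine form times the difference of `P`.
degreeBelow-affine-* : ∀ {s} d (a : Vec ℚ s) (k : ℚ) {P : Vec Bool s → ℚ} →
  DegreeBelow d P → DegreeBelow (suc d) (λ x → (dot a x ℚ.+ k) ℚ.* P x)
degreeBelow-affine-* zero a k {P} dP =
  degreeBelow-suc zero λ x → trans (cong ((dot a x ℚ.+ k) ℚ.*_) (dP x))
    (ℚₚ.*-zeroʳ (dot a x ℚ.+ k))
degreeBelow-affine-* {zero} (suc d) a k dP = tt
degreeBelow-affine-* {suc s} (suc d) (a ∷ as) k {P} (dP , dΔP) =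
  -- Fixing the first bit only moves its term into the constant.
  (λ b → let fP = degreeBelow-affine-* (suc d) as (a ℚ.* ⟦ b ⟧ ℚ.+ k) (dP b) in
     degreeBelow-linear (suc (suc d)) 1ℚ 0ℚ fP fP
       (λ x → shift-const a ⟦ b ⟧ (dot as x) k (P (b ∷ x))
         ((dot as x ℚ.+ (a ℚ.* ⟦ b ⟧ ℚ.+ k)) ℚ.* P (b ∷ x)))) ,
  degreeBelow-linear (suc d) a 1ℚ (dP false) (degreeBelow-affine-* d as (a ℚ.+ k) dΔP)
    (λ x → affine-Δ a (dot as x) k (P (true ∷ x)) (P (false ∷ x)))

degreeBelow-const : ∀ {s} (c : ℚ) → DegreeBelow {s} 1 (λ _ → c)
degreeBelow-const {zero}  c = tt
degreeBelow-const {suc s} c = (λ b → degreeBelow-const c) , (λ x → ℚₚ.+-inverseʳ c)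

-- Coordinate flips and levels of a linear form

≡-or-≡not : ∀ c b → c ≡ b ⊎ c ≡ not b
≡-or-≡not true  true  = inj₁ refl
≡-or-≡not true  false = inj₂ refl
≡-or-≡not false true  = inj₂ refl
≡-or-≡not false false = inj₁ refl

ascents : ∀ {_≺_ : Rel ℚ 0ℓ} → Decidable _≺_ → ∀ {s} → Vec ℚ s → Vec Bool s → ℕ
ascents _≺?_ []       []      = 0
ascents _≺?_ (a ∷ as) (b ∷ x) =
  (if ⌊ (a ℚ.* ⟦ b ⟧) ≺? (a ℚ.* ⟦ not b ⟧) ⌋ then 1 else 0) ℕ.+ ascents _≺?_ as x

-- Alon–Füredi on the subcube spanned by the coordinates whose flip increases a linear form,
-- abstract in the order, since decreasing flips are needed as well.
module Ascent
  {_≺_ : Rel ℚ 0ℓ} (_≺?_ : Decidable _≺_) (≺-trans : Transitive _≺_)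
  (+-monoˡ-≺ : ∀ r {p q} → p ≺ q → (p ℚ.+ r) ≺ (q ℚ.+ r))
  (+-monoʳ-≺ : ∀ r {p q} → p ≺ q → (r ℚ.+ p) ≺ (r ℚ.+ q))
  where

  -- Induction on coordinates. A non-ascending first coordinate is frozen. An ascending one uses up
  -- one ascent and one degree: `P` vanishes at the flipped point, and the difference of the two
  -- halves, of lower degree, vanishes at `x` by induction.
  vanishes-above⇒vanishes : ∀ {s} d (a : Vec ℚ s) (x : Vec Bool s) {P : Vec Bool s → ℚ} →
    DegreeBelow d P → d ≤ ascents _≺?_ a x →
    (∀ y → dot a x ≺ dot a y → P y ≡ 0ℚ) → P x ≡ 0ℚ
  vanishes-above⇒vanishes zero a x dP _ _ = dP x
  vanishes-above⇒vanishes (suc d) [] [] dP () _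
  vanishes-above⇒vanishes (suc d) (a ∷ as) (b ∷ x) {P} (dP , dΔP) d≤ P-above
    with (a ℚ.* ⟦ b ⟧) ≺? (a ℚ.* ⟦ not b ⟧)
  ... | no  _    = vanishes-above⇒vanishes (suc d) as x (dP b) d≤
                     (λ y x≺y → P-above (b ∷ y) (+-monoʳ-≺ (a ℚ.* ⟦ b ⟧) x≺y))
  ... | yes flip = other b (P-above (not b ∷ x) (+-monoˡ-≺ (dot as x) flip))
    where
    -- Flipping `b` goes up, so a rise in the other coordinates suffices whatever the first bit;
    -- hence both halves vanish above `x`.
    below : ∀ c y → dot as x ≺ dot as y → c ≡ b ⊎ c ≡ not b →
            dot (a ∷ as) (b ∷ x) ≺ dot (a ∷ as) (c ∷ y)
    below c y x≺y (inj₁ refl) = +-monoʳ-≺ (a ℚ.* ⟦ b ⟧) x≺y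
    below c y x≺y (inj₂ refl) = ≺-trans (+-monoʳ-≺ (a ℚ.* ⟦ b ⟧) x≺y) (+-monoˡ-≺ (dot as y) flip)
    P-side : ∀ c y → dot as x ≺ dot as y → P (c ∷ y) ≡ 0ℚ
    P-side c y x≺y = P-above (c ∷ y) (below c y x≺y (≡-or-≡not c b))
    ΔP≡0 : P (true ∷ x) - P (false ∷ x) ≡ 0ℚ
    ΔP≡0 = vanishes-above⇒vanishes d as x dΔP (ℕₚ.≤-pred d≤) (λ y x≺y →
      cong₂ _-_ (P-side true y x≺y) (P-side false y x≺y))
    P-equal : P (true ∷ x) ≡ P (false ∷ x)
    P-equal = x∙y⁻¹≈ε⇒x≈y _ _ ΔP≡0
    other : ∀ b → P (not b ∷ x) ≡ 0ℚ → P (b ∷ x) ≡ 0ℚ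
    other true  eq = trans P-equal eq
    other false eq = trans (sym P-equal) eq

open Ascent ℚₚ._<?_ ℚₚ.<-trans (λ r → ℚₚ.+-monoˡ-< r) (λ r → ℚₚ.+-monoʳ-< r)
open Ascent ℚₚ._>?_ (λ p>q q>r → ℚₚ.<-trans q>r p>q) (λ r → ℚₚ.+-monoˡ-< r) (λ r → ℚₚ.+-monoʳ-< r)
  using () renaming (vanishes-above⇒vanishes to vanishes-below⇒vanishes)

flip-constant⇒≡0 : ∀ a b → a ℚ.* ⟦ b ⟧ ≡ a ℚ.* ⟦ not b ⟧ → a ≡ 0ℚ
flip-constant⇒≡0 a true  eq = trans (sym (ℚₚ.*-identityʳ a)) (trans eq (ℚₚ.*-zeroʳ a))
flip-constant⇒≡0 a false eq = trans (sym (ℚₚ.*-identityʳ a)) (trans (sym eq) (ℚₚ.*-zeroʳ a))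

-- Flipping a bit with nonzero coefficient changes its term, hence moves it strictly up or strictly
-- down.
nnz≤ascents+descents : ∀ {s} (a : Vec ℚ s) c x →
  nnz (form a c) ≤ ascents ℚₚ._<?_ a x ℕ.+ ascents ℚₚ._>?_ a x
nnz≤ascents+descents [] c [] = z≤n
nnz≤ascents+descents (a ∷ as) c (b ∷ x) = step
  where
  U = ascents ℚₚ._<?_ as x
  V = ascents ℚₚ._>?_ as x
  ih : nnz (form as c) ≤ U ℕ.+ V
  ih = nnz≤ascents+descents as c x
  step : nnz (form (a ∷ as) c) ≤
         ascents ℚₚ._<?_ (a ∷ as) (b ∷ x) ℕ.+ ascents ℚₚ._>?_ (a ∷ as) (b ∷ x)
  step with a ℚₚ.≟ 0ℚ | (a ℚ.* ⟦ b ⟧) ℚₚ.<? (a ℚ.* ⟦ not b ⟧) | (a ℚ.* ⟦ b ⟧) ℚₚ.>? (a ℚ.* ⟦ not b ⟧)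
  ... | yes _  | up    | down  = ℕₚ.≤-trans ih (ℕₚ.+-mono-≤
          (ℕₚ.m≤n+m U (if ⌊ up ⌋ then 1 else 0)) (ℕₚ.m≤n+m V (if ⌊ down ⌋ then 1 else 0)))
  ... | no _   | yes _ | down  = s≤s (ℕₚ.≤-trans ih (ℕₚ.+-monoʳ-≤ U
          (ℕₚ.m≤n+m V (if ⌊ down ⌋ then 1 else 0))))
  ... | no _   | no _  | yes _ = ℕₚ.≤-trans (s≤s ih) (ℕₚ.≤-reflexive (sym (ℕₚ.+-suc U V)))
  ... | no a≢0 | no ≮  | no ≯  with ℚₚ.<-cmp (a ℚ.* ⟦ b ⟧) (a ℚ.* ⟦ not b ⟧)
  ...   | tri< < _ _ = ⊥-elim (≮ <)
  ...   | tri≈ _ ≈ _ = ⊥-elim (a≢0 (flip-constant⇒≡0 a b ≈))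
  ...   | tri> _ _ > = ⊥-elim (≯ >)

-- Systems of disequalities

ev : ∀ {n} → Form n → Vec Bool n → ℚ
ev f x = dot (coeffs f) x ℚ.+ const f

prod : ∀ {n} → List (Form n) → Vec Bool n → ℚ
prod []      x = 1ℚ
prod (f ∷ Ψ) x = ev f x ℚ.* prod Ψ x

-- A single nonvanishing product encodes all disequalities, and its degree is at most `length Ψ`.
Sat : ∀ {n} → List (Form n) → Vec Bool n → Set
Sat Ψ x = prod Ψ x ≢ 0ℚ

sat-∷ : ∀ {n} {f : Form n} Ψ {x} → ev f x ≢ 0ℚ → Sat Ψ x → Sat (f ∷ Ψ) x
sat-∷ Ψ = *-≢0

sat-head : ∀ {n} {f : Form n} Ψ {x} → Sat (f ∷ Ψ) x → ev f x ≢ 0ℚ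
sat-head Ψ {x} sat f≡0 = sat (trans (cong (ℚ._* prod Ψ x) f≡0) (ℚₚ.*-zeroˡ (prod Ψ x)))

sat-tail : ∀ {n} (f : Form n) Ψ {x} → Sat (f ∷ Ψ) x → Sat Ψ x
sat-tail f Ψ {x} sat Ψ≡0 = sat (trans (cong (ev f x ℚ.*_) Ψ≡0) (ℚₚ.*-zeroʳ (ev f x)))

degreeBelow-prod : ∀ {n} (Ψ : List (Form n)) → DegreeBelow (suc (length Ψ)) (prod Ψ)
degreeBelow-prod []             = degreeBelow-const 1ℚ
degreeBelow-prod (form a k ∷ Ψ) = degreeBelow-affine-* (suc (length Ψ)) a k (degreeBelow-prod Ψ)

half-≤ : ∀ m p q → suc (2 * m) ≤ p ℕ.+ q → suc m ≤ p ⊎ suc m ≤ q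
half-≤ m p q 2m<p+q with suc m ℕₚ.≤? p | suc m ℕₚ.≤? q
... | yes m<p | _       = inj₁ m<p
... | no  _   | yes m<q = inj₂ m<q
... | no  m≮p | no  m≮q = ⊥-elim (ℕₚ.<⇒≱ 2m<p+q
  (ℕₚ.+-mono-≤ (ℕₚ.≮⇒≥ m≮p) (ℕₚ.≤-trans (ℕₚ.≮⇒≥ m≮q) (ℕₚ.m≤m+n m 0))))

-- One direction offers more than `length Ψ` flips at `x`. Were `g` constant on the solutions, the
-- product of `Ψ` would vanish strictly beyond the level of `x` in that direction, hence at `x` too.
wide-not-constant : ∀ {n} (Ψ : List (Form n)) (g : Form n) {x} →
  Sat Ψ x → suc (2 * length Ψ) ≤ nnz g → ¬ (∀ y → Sat Ψ y → ev g y ≡ ev g x)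
wide-not-constant Ψ g@(form a k) {x} sat wide const-g =
  sat (from (half-≤ (length Ψ) (ascents ℚₚ._<?_ a x) (ascents ℚₚ._>?_ a x)
    (ℕₚ.≤-trans wide (nnz≤ascents+descents a k x))))
  where
  off-level : ∀ y → dot a y ≢ dot a x → prod Ψ y ≡ 0ℚ
  off-level y ≢ with prod Ψ y ℚₚ.≟ 0ℚ
  ... | yes ≡0   = ≡0
  ... | no  saty = ⊥-elim (≢ (+-cancelʳ k _ _ (const-g y saty)))
  from : suc (length Ψ) ≤ ascents ℚₚ._<?_ a x ⊎ suc (length Ψ) ≤ ascents ℚₚ._>?_ a x → prod Ψ x ≡ 0ℚ
  from (inj₁ ≤asc)  = vanishes-above⇒vanishes _ a x (degreeBelow-prod Ψ) ≤asc
    (λ y x<y → off-level y (λ eq → ℚₚ.<-irrefl (sym eq) x<y))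
  from (inj₂ ≤desc) = vanishes-below⇒vanishes _ a x (degreeBelow-prod Ψ) ≤desc
    (λ y y<x → off-level y (λ eq → ℚₚ.<-irrefl eq y<x))

nonzero-somewhere? : ∀ {s} (P : Vec Bool s → ℚ) → (∃ λ x → P x ≢ 0ℚ) ⊎ (∀ x → P x ≡ 0ℚ)
nonzero-somewhere? {zero} P with P [] ℚₚ.≟ 0ℚ
... | yes ≡0 = inj₂ λ { [] → ≡0 }
... | no  ≢0 = inj₁ ([] , ≢0)
nonzero-somewhere? {suc s} P
  with nonzero-somewhere? (λ x → P (true ∷ x)) | nonzero-somewhere? (λ x → P (false ∷ x))
... | inj₁ (x , ≢0) | _             = inj₁ (true ∷ x , ≢0)
... | inj₂ _        | inj₁ (x , ≢0) = inj₁ (false ∷ x , ≢0)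
... | inj₂ t≡0      | inj₂ f≡0      = inj₂ λ { (true ∷ x) → t≡0 x ; (false ∷ x) → f≡0 x }

-- Search over the cube decides whether `Ψ` forces `f` to vanish; this selects the case at a
-- resolution step.
extend? : ∀ {n} (f : Form n) Ψ → ∃ (Sat (f ∷ Ψ)) ⊎ (∀ x → Sat Ψ x → ev f x ≡ 0ℚ)
extend? f Ψ with nonzero-somewhere? (prod (f ∷ Ψ))
... | inj₁ sat = inj₁ sat
... | inj₂ ≡0  = inj₂ vanishes
  where
  vanishes : ∀ x → Sat Ψ x → ev f x ≡ 0ℚ
  vanishes x sat with ev f x ℚₚ.≟ 0ℚ
  ... | yes f≡0 = f≡0
  ... | no  f≢0 = ⊥-elim (sat-∷ {f = f} Ψ f≢0 sat (≡0 x))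

-- Evaluation of the forms occurring in the rules

dot-zero : ∀ {n} (x : Vec Bool n) → dot (Vec.replicate n 0ℚ) x ≡ 0ℚ
dot-zero []      = refl
dot-zero (b ∷ x) = cong₂ ℚ._+_ (ℚₚ.*-zeroˡ ⟦ b ⟧) (dot-zero x)

dot-var : ∀ {n} (i : Fin n) x → dot (coeffs (var i)) x ≡ ⟦ lookup x i ⟧
dot-var zero (b ∷ x) = trans (cong₂ ℚ._+_ (ℚₚ.*-identityˡ ⟦ b ⟧) (dot-zero x)) (ℚₚ.+-identityʳ ⟦ b ⟧)
dot-var (suc i) (b ∷ x) = trans (cong₂ ℚ._+_ (ℚₚ.*-zeroˡ ⟦ b ⟧) (dot-var i x)) (ℚₚ.+-identityˡ _)

dot-lincomb : ∀ {n} α β (a b : Vec ℚ n) x →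
  dot (Vec.zipWith (λ u v → α ℚ.* u ℚ.+ β ℚ.* v) a b) x ≡ α ℚ.* dot a x ℚ.+ β ℚ.* dot b x
dot-lincomb α β [] [] [] = sym (cong₂ ℚ._+_ (ℚₚ.*-zeroʳ α) (ℚₚ.*-zeroʳ β))
dot-lincomb α β (u ∷ a) (v ∷ b) (t ∷ x) =
  trans (cong ((α ℚ.* u ℚ.+ β ℚ.* v) ℚ.* ⟦ t ⟧ ℚ.+_) (dot-lincomb α β a b x))
    (lincomb-step α β u v ⟦ t ⟧ (dot a x) (dot b x))

ev-lincomb : ∀ {n} α (f : Form n) β g x →
  ev (lincomb α f β g) x ≡ α ℚ.* ev f x ℚ.+ β ℚ.* ev g x
ev-lincomb α (form a c) β (form b d) x =
  trans (cong (ℚ._+ (α ℚ.* c ℚ.+ β ℚ.* d)) (dot-lincomb α β a b x))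
    (lincomb-const α β (dot a x) (dot b x) c d)

ev-lincombʳ : ∀ {n} α (f : Form n) β g x → ev f x ≡ 0ℚ →
  ev (lincomb α f β g) x ≡ β ℚ.* ev g x
ev-lincombʳ α f β g x f≡0 = begin
  ev (lincomb α f β g) x            ≡⟨ ev-lincomb α f β g x ⟩
  α ℚ.* ev f x ℚ.+ β ℚ.* ev g x     ≡⟨ cong (λ p → α ℚ.* p ℚ.+ β ℚ.* ev g x) f≡0 ⟩
  α ℚ.* 0ℚ ℚ.+ β ℚ.* ev g x         ≡⟨ cong (ℚ._+ β ℚ.* ev g x) (ℚₚ.*-zeroʳ α) ⟩
  0ℚ ℚ.+ β ℚ.* ev g x               ≡⟨ ℚₚ.+-identityˡ _ ⟩
  β ℚ.* ev g x                      ∎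
  where open ≡-Reasoning

ev-lincombˡ : ∀ {n} α (f : Form n) β g x → ev g x ≡ 0ℚ →
  ev (lincomb α f β g) x ≡ α ℚ.* ev f x
ev-lincombˡ α f β g x g≡0 = begin
  ev (lincomb α f β g) x            ≡⟨ ev-lincomb α f β g x ⟩
  α ℚ.* ev f x ℚ.+ β ℚ.* ev g x     ≡⟨ cong (λ p → α ℚ.* ev f x ℚ.+ β ℚ.* p) g≡0 ⟩
  α ℚ.* ev f x ℚ.+ β ℚ.* 0ℚ         ≡⟨ cong (α ℚ.* ev f x ℚ.+_) (ℚₚ.*-zeroʳ β) ⟩
  α ℚ.* ev f x ℚ.+ 0ℚ               ≡⟨ ℚₚ.+-identityʳ _ ⟩
  α ℚ.* ev f x                      ∎
  where open ≡-Reasoning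

-- refuted b i and forced b i are the literal forms of the i-th axiom that vanish
-- at x_i = b and at x_i ≠ b respectively.
refuted forced : ∀ {n} → Bool → Fin n → Form n
refuted true  = varMinus1
refuted false = var
forced b = refuted (not b)

ev-refuted : ∀ {n} b (i : Fin n) x → lookup x i ≡ b → ev (refuted b i) x ≡ 0ℚ
ev-refuted true  i x eq = cong (λ p → p - 1ℚ) (trans (dot-var i x) (cong ⟦_⟧ eq))
ev-refuted false i x eq = cong (ℚ._+ 0ℚ) (trans (dot-var i x) (cong ⟦_⟧ eq))

ev-forced : ∀ {n} b (i : Fin n) x → lookup x i ≡ b → ev (forced b i) x ≢ 0ℚ
ev-forced true  i x eq ≡0 with trans (sym ≡0) (cong (ℚ._+ 0ℚ) (trans (dot-var i x) (cong ⟦_⟧ eq)))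
... | ()
ev-forced false i x eq ≡0 with trans (sym ≡0) (cong (λ p → p - 1ℚ) (trans (dot-var i x) (cong ⟦_⟧ eq)))
... | ()

forced-≢0⇒ : ∀ {n} b (i : Fin n) x → ev (forced b i) x ≢ 0ℚ → lookup x i ≡ b
forced-≢0⇒ b i x ≢0 with ≡-or-≡not (lookup x i) b
... | inj₁ eq = eq
... | inj₂ eq = ⊥-elim (≢0 (ev-refuted (not b) i x eq))

refuted-∈ : ∀ {n} b (i : Fin n) → refuted b i ∈ var i ∷ varMinus1 i ∷ []
refuted-∈ true  i = there (here refl)
refuted-∈ false i = here refl

-- Sizes

nnz-var>0 : ∀ {n} (i : Fin n) c → 1 ≤ nnz (form (coeffs (var i)) c)
nnz-var>0 zero    c = s≤s z≤n
nnz-var>0 (suc i) c = nnz-var>0 i c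

clauseSize-∈ : ∀ {n} {f : Form n} {Γ} → f ∈ Γ → formSize f ≤ clauseSize Γ
clauseSize-∈ (here refl) = ℕₚ.m≤m+n _ _
clauseSize-∈ {Γ = h ∷ _} (there f∈Γ) = ℕₚ.≤-trans (clauseSize-∈ f∈Γ) (ℕₚ.m≤n+m _ (formSize h))

size>0 : ∀ {n} {Γ : Clause n} (d : Deriv Γ) → 1 ≤ size d
size>0 (axiom i (_ , ⊇)) = ℕₚ.≤-trans (nnz-var>0 i 0ℚ)
  (ℕₚ.≤-trans (ℕₚ.m≤m+n _ _) (clauseSize-∈ (⊇ (here refl))))
size>0 (res f g C D α β d₁ d₂ _ _ _) = ℕₚ.≤-trans (size>0 d₂) (ℕₚ.m≤n+m _ _)
size>0 (simp a C _ d _ _) = ℕₚ.≤-trans (size>0 d) (ℕₚ.m≤n+m _ _)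
size>0 (weak f d _) = ℕₚ.≤-trans (size>0 d) (ℕₚ.m≤n+m _ _)

-- The branching argument

-- `g` may be any form with at least `w` variables, so the invariant does not refer to the original
-- clause.
Tame : ∀ {n} → ℕ → List (Form n) → Form n → Set
Tame w Ψ h =
  (∀ x → Sat Ψ x → ev h x ≢ 0ℚ) ⊎
  (∃ λ g → w ≤ nnz g × ∃ λ c → c ≢ 0ℚ × (∀ x → Sat Ψ x → ev h x ≡ c ℚ.* ev g x))

tame-∷ : ∀ {n w} (f : Form n) Ψ h → Tame w Ψ h → Tame w (f ∷ Ψ) h
tame-∷ f Ψ h (inj₁ ≢0) = inj₁ λ x sat → ≢0 x (sat-tail f Ψ sat)
tame-∷ f Ψ h (inj₂ (g , wide , c , c≢0 , eq)) =
  inj₂ (g , wide , c , c≢0 , λ x sat → eq x (sat-tail f Ψ sat))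

-- Carries the invariant from the resolvent `l` to the surviving resolved form `h` once the other
-- resolved form vanishes on the solutions.
tame-unscale : ∀ {n w} Ψ {x : Vec Bool n} → Sat Ψ x → suc (2 * length Ψ) ≤ w →
  ∀ l h β → (∀ y → Sat Ψ y → ev l y ≡ β ℚ.* ev h y) → Tame w Ψ l → Tame w Ψ h
tame-unscale Ψ sat narrow l h β l≡βh (inj₁ l≢0) = inj₁ λ y saty h≡0 →
  l≢0 y saty (trans (l≡βh y saty) (trans (cong (β ℚ.*_) h≡0) (ℚₚ.*-zeroʳ β)))
tame-unscale Ψ sat narrow l h β l≡βh (inj₂ (g , wide , c , c≢0 , l≡cg)) with β ℚₚ.≟ 0ℚ
-- With scalar 0 the wide form `g` would vanish on all solutions.
... | yes refl = ⊥-elim (wide-not-constant Ψ g sat (ℕₚ.≤-trans narrow wide)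
        (λ y saty → trans (g≡0 y saty) (sym (g≡0 _ sat))))
  where
  g≡0 : ∀ y → Sat Ψ y → ev g y ≡ 0ℚ
  g≡0 y saty = *-cancelˡ-≢0 c≢0 (begin
    c ℚ.* ev g y   ≡⟨ l≡cg y saty ⟨
    ev l y         ≡⟨ l≡βh y saty ⟩
    0ℚ ℚ.* ev h y  ≡⟨ ℚₚ.*-zeroˡ (ev h y) ⟩
    0ℚ             ≡⟨ ℚₚ.*-zeroʳ c ⟨
    c ℚ.* 0ℚ       ∎)
    where open ≡-Reasoning
... | no β≢0 = inj₂ (g , wide , (ℚ.1/ β) ℚ.* c , *-≢0 β⁻¹≢0 c≢0 , h≡)
  where
  instance _ = ℚ.≢-nonZero β≢0
  β⁻¹≢0 : ℚ.1/ β ≢ 0ℚ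
  β⁻¹≢0 eq with trans (sym (ℚₚ.*-inverseˡ β)) (trans (cong (ℚ._* β) eq) (ℚₚ.*-zeroˡ β))
  ... | ()
  h≡ : ∀ y → Sat Ψ y → ev h y ≡ (ℚ.1/ β) ℚ.* c ℚ.* ev g y
  h≡ y saty = *-cancelˡ-≢0 β≢0 (begin
    β ℚ.* ev h y                          ≡⟨ l≡βh y saty ⟨
    ev l y                                ≡⟨ l≡cg y saty ⟩
    c ℚ.* ev g y                          ≡⟨ ℚₚ.*-identityˡ _ ⟨
    1ℚ ℚ.* (c ℚ.* ev g y)                 ≡⟨ cong (ℚ._* (c ℚ.* ev g y)) (ℚₚ.*-inverseʳ β) ⟨
    β ℚ.* (ℚ.1/ β) ℚ.* (c ℚ.* ev g y)     ≡⟨ ℚₚ.*-assoc β (ℚ.1/ β) _ ⟩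
    β ℚ.* ((ℚ.1/ β) ℚ.* (c ℚ.* ev g y))   ≡⟨ cong (β ℚ.*_) (ℚₚ.*-assoc (ℚ.1/ β) c (ev g y)) ⟨
    β ℚ.* ((ℚ.1/ β) ℚ.* c ℚ.* ev g y)     ∎)
    where open ≡-Reasoning

-- The literal refuted by `x` vanishes there, so it would be a multiple of a wide `g`. Adding the
-- opposite disequality fixes the variable and makes `g` zero on the solutions; this one extra
-- disequality accounts for `suc (length Ψ)`.
axiom-not-tame : ∀ {n w} Ψ {x : Vec Bool n} (i : Fin n) → Sat Ψ x →
  suc (2 * suc (length Ψ)) ≤ w → ¬ (∀ b → Tame w Ψ (refuted b i))
axiom-not-tame Ψ {x} i sat narrow tame with tame (lookup x i)
... | inj₁ ≢0 = ≢0 x sat (ev-refuted (lookup x i) i x refl)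
... | inj₂ (g , wide , c , c≢0 , eq) =
  wide-not-constant Ψ⁺ g sat⁺ (ℕₚ.≤-trans narrow wide) λ y saty →
    *-cancelˡ-≢0 c≢0 (trans (cg≡0 y saty) (sym (cg≡0 x sat⁺)))
  where
  b = lookup x i
  Ψ⁺ = forced b i ∷ Ψ
  sat⁺ : Sat Ψ⁺ x
  sat⁺ = sat-∷ {f = forced b i} Ψ (ev-forced b i x refl) sat
  cg≡0 : ∀ y → Sat Ψ⁺ y → c ℚ.* ev g y ≡ 0ℚ
  cg≡0 y saty = trans (sym (eq y (sat-tail (forced b i) Ψ saty)))
    (ev-refuted b i y (forced-≢0⇒ b i y (sat-head {f = forced b i} Ψ saty)))

module _ {n w K : ℕ} (K<w : suc (2 * suc K) ≤ w) where

  narrow⁺ : ∀ {m} r → m ℕ.+ r ≤ K → suc (2 * suc m) ≤ w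
  narrow⁺ r m+r≤K =
    ℕₚ.≤-trans (s≤s (ℕₚ.*-monoʳ-≤ 2 (s≤s (ℕₚ.≤-trans (ℕₚ.m≤m+n _ r) m+r≤K)))) K<w

  narrow : ∀ {m} r → m ℕ.+ r ≤ K → suc (2 * m) ≤ w
  narrow r m+r≤K = ℕₚ.≤-trans (s≤s (ℕₚ.*-monoʳ-≤ 2 (ℕₚ.n≤1+n _))) (narrow⁺ r m+r≤K)

  tame-premise : ∀ (Ψ : List (Form n)) {Γ f C} → Γ ≈ (f ∷ C) → Tame w Ψ f →
    (∀ {h} → h ∈ C → Tame w Ψ h) → ∀ {h} → h ∈ Γ → Tame w Ψ h
  tame-premise Ψ (⊆ , _) tf tC h∈Γ with ⊆ h∈Γ
  ... | here refl  = tf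
  ... | there h∈C  = tC h∈C

  -- Induction on the derivation; `r` is the number of doublings still allowed, and `K` bounds those
  -- made plus those left.
  2^≤size : ∀ {Γ : Clause n} (d : Deriv Γ) (Ψ : List (Form n)) → ∃ (Sat Ψ) →
    (∀ {h} → h ∈ Γ → Tame w Ψ h) → ∀ r → length Ψ ℕ.+ r ≤ K → 2 ^ r ≤ size d
  2^≤size (axiom i (_ , ⊇)) Ψ (x , sat) tame r bound =
    ⊥-elim (axiom-not-tame Ψ i sat (narrow⁺ r bound) (λ b → tame (⊇ (refuted-∈ b i))))
  2^≤size (simp a C a≢0 d Γ≈ (_ , ⊇)) Ψ sat tame r bound =
    ℕₚ.≤-trans
      (2^≤size d Ψ sat (tame-premise Ψ Γ≈ (inj₁ const≢0) (λ h∈C → tame (⊇ h∈C))) r bound)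
      (ℕₚ.m≤n+m _ _)
    where
    const≢0 : ∀ x → Sat Ψ x → ev (constForm a) x ≢ 0ℚ
    const≢0 x _ ≡0 = a≢0 (trans (sym (ℚₚ.+-identityˡ a)) (trans (cong (ℚ._+ a) (sym (dot-zero x))) ≡0))
  2^≤size (weak f d (_ , ⊇)) Ψ sat tame r bound =
    ℕₚ.≤-trans (2^≤size d Ψ sat (λ h∈Γ → tame (⊇ (there h∈Γ))) r bound) (ℕₚ.m≤n+m _ _)
  2^≤size {Γ} (res {Γ₁} {Γ₂} f g C D α β d₁ d₂ Γ₁≈ Γ₂≈ (_ , ⊇)) Ψ (x , sat) tame r bound
    = branch (extend? f Ψ) (extend? g Ψ) r bound
    where
    l = lincomb α f β g
    tame-l : Tame w Ψ l
    tame-l = tame (⊇ (∈-++⁺ʳ C (∈-++⁺ʳ D (here refl))))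
    tame-C : ∀ {h} → h ∈ C → Tame w Ψ h
    tame-C h∈C = tame (⊇ (∈-++⁺ˡ h∈C))
    tame-D : ∀ {h} → h ∈ D → Tame w Ψ h
    tame-D h∈D = tame (⊇ (∈-++⁺ʳ C (∈-++⁺ˡ h∈D)))
    S = clauseSize Γ
    branch : ∃ (Sat (f ∷ Ψ)) ⊎ (∀ y → Sat Ψ y → ev f y ≡ 0ℚ) →
             ∃ (Sat (g ∷ Ψ)) ⊎ (∀ y → Sat Ψ y → ev g y ≡ 0ℚ) →
             ∀ r → length Ψ ℕ.+ r ≤ K → 2 ^ r ≤ S ℕ.+ size d₁ ℕ.+ size d₂
    branch (inj₂ f≡0) _ r bound = ℕₚ.≤-trans
      (2^≤size d₂ Ψ (x , sat)
        (tame-premise Ψ Γ₂≈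
          (tame-unscale Ψ sat (narrow r bound) l g β
            (λ y saty → ev-lincombʳ α f β g y (f≡0 y saty)) tame-l)
          tame-D) r bound)
      (ℕₚ.m≤n+m _ _)
    branch (inj₁ _) (inj₂ g≡0) r bound = ℕₚ.≤-trans
      (2^≤size d₁ Ψ (x , sat)
        (tame-premise Ψ Γ₁≈
          (tame-unscale Ψ sat (narrow r bound) l f α
            (λ y saty → ev-lincombˡ α f β g y (g≡0 y saty)) tame-l)
          tame-C) r bound)
      (ℕₚ.≤-trans (ℕₚ.m≤n+m _ S) (ℕₚ.m≤m+n _ _))
    -- The budget is spent, and any derivation has size at least 1.
    branch (inj₁ _) (inj₁ _) zero bound = ℕₚ.≤-trans (size>0 d₂) (ℕₚ.m≤n+m _ _)
    -- Tree-likeness lets the two premise sizes add, each at least `2 ^ r`.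
    branch (inj₁ satf) (inj₁ satg) (suc r) bound = ℕₚ.+-mono-≤
      (ℕₚ.≤-trans
        (2^≤size d₁ (f ∷ Ψ) satf
          (tame-premise (f ∷ Ψ) Γ₁≈ (inj₁ (λ y → sat-head {f = f} Ψ))
            (λ {h} h∈C → tame-∷ f Ψ h (tame-C h∈C))) r bound⁺)
        (ℕₚ.m≤n+m _ S))
      (ℕₚ.≤-trans (ℕₚ.≤-reflexive (ℕₚ.+-identityʳ (2 ^ r)))
        (2^≤size d₂ (g ∷ Ψ) satg
          (tame-premise (g ∷ Ψ) Γ₂≈ (inj₁ (λ y → sat-head {f = g} Ψ))
            (λ {h} h∈D → tame-∷ g Ψ h (tame-D h∈D))) r bound⁺))
      where
      bound⁺ : suc (length Ψ ℕ.+ r) ≤ K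
      bound⁺ = subst (_≤ K) (ℕₚ.+-suc (length Ψ) r) bound

-- Choice of parameters

wide-enough : ∀ n → 26 ≤ n → ∀ k → k * k ≤ n → 2 * suc (2 * suc k) ≤ n
wide-enough n 26≤n k k²≤n with k ℕₚ.≤? 5
-- At `k = 5` the left side is exactly 26, whence the threshold.
... | yes k≤5 = ℕₚ.≤-trans (ℕₚ.*-monoʳ-≤ 2 (s≤s (ℕₚ.*-monoʳ-≤ 2 (s≤s k≤5)))) 26≤n
-- With `k = 6 + j`, the square exceeds `4k + 6` by `6 + 8j + j²`.
... | no  k≰5 = ℕₚ.≤-trans (ℕₚ.≤-trans (ℕₚ.m≤m+n _ _) (ℕₚ.≤-reflexive eq)) k²≤n
  where
  open +-*-Solver
  j = k ℕ.∸ 6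
  6+j≡k : 6 ℕ.+ j ≡ k
  6+j≡k = ℕₚ.m+[n∸m]≡n (ℕₚ.≰⇒> k≰5)
  eq : 2 * suc (2 * suc k) ℕ.+ (6 ℕ.+ 8 * j ℕ.+ j * j) ≡ k * k
  eq = subst (λ k → 2 * suc (2 * suc k) ℕ.+ (6 ℕ.+ 8 * j ℕ.+ j * j) ≡ k * k) 6+j≡k
    (solve 1 (λ j →
      con 2 :* (con 1 :+ con 2 :* (con 1 :+ (con 6 :+ j))) :+ (con 6 :+ con 8 :* j :+ j :* j)
      := (con 6 :+ j) :* (con 6 :+ j)) refl j)

mainTheorem3 : Σ ℕ λ c → Σ ℕ λ n₀ →
    (n : ℕ) → n₀ ≤ n → (N : ℕ) → 1 ≤ N → (g : Vec (Form n) N) →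
    ((j : Fin N) → n ≤ 2 * nnz (lookup g j)) →
    Tautology (bigClause g) →
    (Γ : Clause n) → Γ ≈ bigClause g → (d : Deriv Γ) →
    (k : ℕ) → k * k ≤ n → 2 ^ k ≤ size d ^ c
mainTheorem3 = 1 , 26 , λ n 26≤n N _ g wide _ Γ (⊆ , _) d k k²≤n →
  let
    tame : ∀ {h} → h ∈ Γ → Tame (suc (2 * suc k)) [] h
    tame {h} h∈Γ =
      let h∈g = Vec∈ₚ.∈-toList⁻ (⊆ h∈Γ)
          j   = VecAny.index h∈g
      in inj₂ (h , ℕₚ.*-cancelˡ-≤ 2 (ℕₚ.≤-trans (wide-enough n 26≤n k k²≤n)
                 (subst (λ f → n ≤ 2 * nnz f) (sym (VecAnyₚ.lookup-index h∈g)) (wide j)))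
               , 1ℚ , (λ ()) , λ x _ → sym (ℚₚ.*-identityˡ (ev h x)))
  in subst (2 ^ k ≤_) (sym (ℕₚ.^-identityʳ (size d)))
       -- Start with no disequalities, which every point satisfies, and with the whole budget `k`
       -- unspent.
       (2^≤size ℕₚ.≤-refl d [] (Vec.replicate n true , λ ()) tame k ℕₚ.≤-refl)
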